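{- For every integer $k\ge 4$, there is no graph $G$ with $\omega(G)=2$, $\chi(G)=k$ and $\chi_{\rho}(G)=k+2$; that is, the triple $(2,k,k+2)$ is not realizable.
   Context: All graphs are finite and simple. $\omega(G)$ is the clique number and $\chi(G)$ the chromatic number of $G$. For a positive integer $i$, an $i$-packing in $G$ is a set $W\subseteq V(G)$ such that any two distinct vertices of $W$ are at distance greater than $i$ in $G$. The packing chromatic number $\chi_{\rho}(G)$ is the smallest integer $k$ such that $V(G)$ can be partitioned into sets $V_1,\dots,V_k$ with $V_i$ an $i$-packing for each $i\in\{1,\dots,k\}$. A triple $(a,b,c)$ is realizable if some graph $G$ has $\omega(G)=a$, $\chi(G)=b$, $\chi_{\rho}(G)=c$. -}

module Defs where

open import Data.Nat using (ℕ; zero; suc; _+_; _≤_)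
open import Data.Fin using (Fin; toℕ)
open import Data.Bool using (Bool; true; false)
open import Data.Product using (Σ; _×_; ∃-syntax)
open import Relation.Binary.PropositionalEquality using (_≡_; _≢_)
open import Relation.Nullary using (¬_)
open import Function.Definitions using (Injective)

record Graph : Set where
  field
    n      : ℕ
    adj    : Fin n → Fin n → Bool
    symm   : ∀ u v → adj u v ≡ adj v u
    irrefl : ∀ v → adj v v ≡ false
open Graph public

Adj : (G : Graph) → Fin (n G) → Fin (n G) → Set
Adj G u v = adj G u v ≡ true

data Walk (G : Graph) : Fin (n G) → Fin (n G) → ℕ → Set where
  here : ∀ {u} → Walk G u u zero
  step : ∀ {u w v m} → Adj G u w → Walk G w v m → Walk G u v (suc m)

-- d_G(u,v) ≤ i  (distance is the length of a shortest walk; infinite if none)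
DistLe : (G : Graph) → Fin (n G) → Fin (n G) → ℕ → Set
DistLe G u v i = ∃[ m ] (m ≤ i × Walk G u v m)

IsClique : (G : Graph) (a : ℕ) → (Fin a → Fin (n G)) → Set
IsClique G a f = Injective _≡_ _≡_ f × (∀ i j → i ≢ j → Adj G (f i) (f j))

HasClique : Graph → ℕ → Set
HasClique G a = Σ (Fin a → Fin (n G)) (IsClique G a)

CliqueNumber : Graph → ℕ → Set
CliqueNumber G a = HasClique G a × (∀ b → HasClique G b → b ≤ a)

ProperColouring : (G : Graph) (k : ℕ) → (Fin (n G) → Fin k) → Set
ProperColouring G k c = ∀ u v → Adj G u v → c u ≢ c v

Colourable : Graph → ℕ → Set
Colourable G k = Σ (Fin (n G) → Fin k) (ProperColouring G k)

ChromaticNumber : Graph → ℕ → Set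
ChromaticNumber G k = Colourable G k × (∀ j → Colourable G j → k ≤ j)

IsPacking : (G : Graph) (i : ℕ) → (Fin (n G) → Set) → Set
IsPacking G i W = ∀ u v → W u → W v → u ≢ v → ¬ DistLe G u v i

-- A packing colouring with k colours: c : V(G) → Fin k, where colour
-- class c⁻¹(j) (i.e. V_{j+1}, colours are 1-based in the paper) is a
-- (j+1)-packing. This is a partition of V(G) into V_1,…,V_k.
PackingColouring : (G : Graph) (k : ℕ) → (Fin (n G) → Fin k) → Set
PackingColouring G k c =
  (j : Fin k) → IsPacking G (suc (toℕ j)) (λ v → c v ≡ j)

PackingColourable : Graph → ℕ → Set
PackingColourable G k = Σ (Fin (n G) → Fin k) (PackingColouring G k)

PackingChromaticNumber : Graph → ℕ → Set
PackingChromaticNumber G k =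
  PackingColourable G k × (∀ j → PackingColourable G j → k ≤ j)

{-# OPTIONS --safe #-}
module Submission where

-- In terms of the paper's colours 1,…,k+2, it suffices to 3-colour the part of G
-- coloured 1,…,6: keeping the other classes gives k−1 colours in all. Within that
-- part, the vertices of colour 1 with at most two neighbours can be coloured last.
-- Call the other vertices of colour 1 rich. They form, together with the vertices
-- of colour 2 that have no rich neighbour, an independent set. The remaining
-- vertices (the core, with colours 2,…,6) span a bipartite graph: a shortest odd
-- closed walk in it is a cycle; around a cycle of length at least 7 the colours
-- would form an infinite sequence in which equal colours c are more than c apart,
-- and a search shows that such a sequence has at most 34 terms; a pentagon
-- carries each of the colours 2,…,6 once, and then its vertex of colour 2 cannot
-- have a rich neighbour in a triangle-free graph.

open import Defs
open import Data.Nat using (ℕ; zero; suc; _≤_; _<_; _+_; _∸_; _%_; _≡ᵇ_; z≤n; s≤s; s≤s⁻¹; s<s; s<s⁻¹; z<s; NonZero)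
open import Data.Nat.Properties
open import Data.Nat.DivMod using (m%n<n; %-distribˡ-+; m<n⇒m%n≡m; n%n≡0; m%n%n≡m%n; [m+n]%n≡m%n)
open import Data.Nat.Induction using (<-rec)
open import Data.Fin as Fin using (Fin; toℕ; fromℕ<; punchOut; splitAt; _↑ˡ_; _↑ʳ_)
open import Data.Fin.Patterns using (0F; 1F; 2F; 3F; 4F)
open import Data.Fin.Properties using (toℕ-injective; toℕ<n; toℕ-fromℕ<; pigeonhole; punchOut-injective; any?; toℕ-↑ˡ; ↑ˡ-injective; ↑ʳ-injective; splitAt-↑ˡ; splitAt-↑ʳ; splitAt⁻¹-↑ˡ; splitAt⁻¹-↑ʳ) renaming (_≟_ to _≟F_)
open import Data.Bool using (Bool; true; false; not; _∧_; _∨_; _xor_) renaming (_≟_ to _≟B_)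
open import Data.Bool.Properties using (∧-comm; ∧-conicalˡ; ∧-conicalʳ; not-¬; not-distribˡ-xor; xor-identityʳ; T-≡)
open import Data.Bool.Solver using (module xor-∧-Solver)
open import Data.List using (List; []; _∷_; allFin; cartesianProduct)
open import Data.List.Membership.Propositional using (_∈_)
open import Data.List.Membership.Propositional.Properties using (∈-allFin; ∈-cartesianProduct⁺)
open import Data.List.Relation.Unary.Any using (here; there)
open import Data.Product using (Σ; _×_; _,_; proj₁; proj₂; ∃-syntax)
open import Data.Sum using (_⊎_; inj₁; inj₂)
open import Data.Empty using (⊥; ⊥-elim)
open import Function using (_∘_)
open import Function.Bundles using (Equivalence)
open import Relation.Nullary using (¬_; Dec; does; yes; no; ¬?)
open import Relation.Nullary.Decidable using (map′; _×-dec_; _→-dec_; dec-true)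
open import Relation.Binary.PropositionalEquality using (_≡_; _≢_; refl; sym; trans; cong; cong₂; subst)

-- Adjacency, triangles and a pigeonhole argument

Adj-sym : (G : Graph) → ∀ {u v} → Adj G u v → Adj G v u
Adj-sym G {u} {v} a = trans (symm G v u) a

Adj⇒≢ : (G : Graph) → ∀ {u v} → Adj G u v → u ≢ v
Adj⇒≢ G {u} a refl with trans (sym a) (irrefl G u)
... | ()

TriangleFree : Graph → Set
TriangleFree G = ∀ {x y z} → Adj G x y → Adj G y z → Adj G z x → ⊥

ω≡2⇒triangleFree : (G : Graph) → CliqueNumber G 2 → TriangleFree G
ω≡2⇒triangleFree G (_ , largest) {x} {y} {z} xy yz zx = 1+n≰n (largest 3 (f , f-injective , f-adjacent))
  where
  f : Fin 3 → Fin (n G)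
  f 0F = x
  f 1F = y
  f 2F = z
  f-adjacent : ∀ i j → i ≢ j → Adj G (f i) (f j)
  f-adjacent 0F 0F i≢j = ⊥-elim (i≢j refl)
  f-adjacent 0F 1F _ = xy
  f-adjacent 0F 2F _ = Adj-sym G zx
  f-adjacent 1F 0F _ = Adj-sym G xy
  f-adjacent 1F 1F i≢j = ⊥-elim (i≢j refl)
  f-adjacent 1F 2F _ = yz
  f-adjacent 2F 0F _ = zx
  f-adjacent 2F 1F _ = Adj-sym G yz
  f-adjacent 2F 2F i≢j = ⊥-elim (i≢j refl)
  f-injective : ∀ {i j} → f i ≡ f j → i ≡ j
  f-injective {i} {j} fi≡fj with i ≟F j
  ... | yes i≡j = i≡j
  ... | no i≢j = ⊥-elim (Adj⇒≢ G (f-adjacent i j i≢j) fi≡fj)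

-- If `y` were missed, punching it out would send `suc m` points injectively into `m` places.
distinct⇒surjective : ∀ {m} (f : Fin (suc m) → Fin (suc m)) → (∀ {i j} → i Fin.< j → f i ≢ f j) →
  ∀ y → ∃[ x ] y ≡ f x
distinct⇒surjective {m} f distinct y with any? (λ x → y ≟F f x)
... | yes hit = hit
... | no missing with pigeonhole (n<1+n m) (λ x → punchOut (missing ∘ (x ,_)))
... | i , j , i<j , eq = ⊥-elim (distinct i<j (punchOut-injective (missing ∘ (i ,_)) (missing ∘ (j ,_)) eq))

-- Odd closed walks and bipartiteness

odd : ℕ → Bool
odd zero = false
odd (suc m) = not (odd m)

odd-+ : ∀ a b → odd (a + b) ≡ odd a xor odd b
odd-+ zero b = refl
odd-+ (suc a) b = trans (cong not (odd-+ a b)) (not-distribˡ-xor (odd a) (odd b))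

_++ʷ_ : ∀ {G u v w a b} → Walk G u v a → Walk G v w b → Walk G u w (a + b)
here ++ʷ q = q
step e p ++ʷ q = step e (p ++ʷ q)

NoOddClosedWalk : Graph → Set
NoOddClosedWalk G = ∀ m u → odd m ≡ true → ¬ Walk G u u m

-- Edges are added one at a time, keeping track of the components and of a 2-colouring of each; the
-- walks inside a component have known parity, so a failure yields an odd closed walk.
module Bipartition (G : Graph) (noOdd : NoOddClosedWalk G) where

  private
    V : Set
    V = Fin (n G)

  WalkOfParity : V → V → Bool → Set
  WalkOfParity u v b = ∃[ m ] (Walk G u v m × odd m ≡ b)

  -- comp and side describe the components, and bipartitions of them, of a
  -- subgraph containing the edges in es.
  record Sides (es : List (V × V)) : Set where
    field
      comp : V → V
      side : V → Bool
      joined : ∀ x y → comp x ≡ comp y → WalkOfParity x y (side x xor side y)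
      split : ∀ u v → (u , v) ∈ es → Adj G u v → comp u ≡ comp v × side u ≡ not (side v)

  through : ∀ {x u v y a b} → WalkOfParity x u a → Adj G u v → WalkOfParity v y b →
    WalkOfParity x y (a xor not b)
  through {a = a} {b} (k , p , pa) e (l , q , qb) =
    k + suc l , p ++ʷ step e q , trans (odd-+ k (suc l)) (cong₂ (λ s t → s xor not t) pa qb)

  -- The component of `v` is absorbed into that of `u`, and its sides are swapped exactly when `u`
  -- and `v` were on equal sides.
  module Join {es} (S : Sides es) {u v} (uv : Adj G u v) (apart : Sides.comp S u ≢ Sides.comp S v) where
    open Sides S
    open xor-∧-Solver

    flip : Bool
    flip = not (side u xor side v)

    comp' : V → V
    comp' x with comp x ≟F comp v
    ... | yes _ = comp u
    ... | no _ = comp x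

    side' : V → Bool
    side' x with comp x ≟F comp v
    ... | yes _ = side x xor flip
    ... | no _ = side x

    flip-both : ∀ a b c → a xor b ≡ (a xor c) xor (b xor c)
    flip-both = solve 3 (λ a b c → (a :+ b) := ((a :+ c) :+ (b :+ c))) refl

    flip-left : ∀ x y s t → (x xor t) xor not (s xor y) ≡ (x xor not (s xor t)) xor y
    -- Over the field of two elements, `not` is addition of `true`.
    flip-left = solve 4 (λ x y s t →
      (x :+ t) :+ (con true :+ (s :+ y)) := (x :+ (con true :+ (s :+ t))) :+ y) refl

    flip-right : ∀ x y s t → (x xor s) xor not (t xor y) ≡ x xor (y xor not (s xor t))
    flip-right = solve 4 (λ x y s t →
      (x :+ s) :+ (con true :+ (t :+ y)) := x :+ (y :+ (con true :+ (s :+ t)))) refl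

    joined' : ∀ x y → comp' x ≡ comp' y → WalkOfParity x y (side' x xor side' y)
    joined' x y eq with comp x ≟F comp v | comp y ≟F comp v
    ... | yes p | yes q = subst (WalkOfParity x y) (flip-both (side x) (side y) flip) (joined x y (trans p (sym q)))
    ... | no _ | no _ = joined x y eq
    ... | yes p | no _ = subst (WalkOfParity x y) (flip-left (side x) (side y) (side u) (side v))
      (through (joined x v p) (Adj-sym G uv) (joined u y eq))
    ... | no _ | yes q = subst (WalkOfParity x y) (flip-right (side x) (side y) (side u) (side v))
      (through (joined x u eq) uv (joined v y (sym q)))

    opposite : ∀ s t → s ≡ not (t xor not (s xor t))
    opposite = solve 2 (λ s t → s := con true :+ (t :+ (con true :+ (s :+ t)))) refl

    split-old : ∀ x y → comp x ≡ comp y → side x ≡ not (side y) → comp' x ≡ comp' y × side' x ≡ not (side' y)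
    split-old x y c s with comp x ≟F comp v | comp y ≟F comp v
    ... | yes _ | yes _ = refl , trans (cong (_xor flip) s) (sym (not-distribˡ-xor (side y) flip))
    ... | no _ | no _ = c , s
    ... | yes p | no q = ⊥-elim (q (trans (sym c) p))
    ... | no p | yes q = ⊥-elim (p (trans c q))

    split-new : comp' u ≡ comp' v × side' u ≡ not (side' v)
    split-new with comp u ≟F comp v | comp v ≟F comp v
    ... | yes p | _ = ⊥-elim (apart p)
    ... | no _ | no q = ⊥-elim (q refl)
    ... | no _ | yes _ = refl , opposite (side u) (side v)

    join : Sides ((u , v) ∷ es)
    join = record
      { comp = comp' ; side = side' ; joined = joined'
      ; split = λ where
          _ _ (here refl) _ → split-new
          x y (there e) a → let c , s = split x y e a in split-old x y c s }

  closing : ∀ s t → s ≢ not t → not (s xor t) ≡ true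
  closing false false _ = refl
  closing false true s≢ = ⊥-elim (s≢ refl)
  closing true false s≢ = ⊥-elim (s≢ refl)
  closing true true _ = refl

  addEdge : ∀ {es} (u v : V) → Sides es → Sides ((u , v) ∷ es)
  addEdge {es} u v S with adj G u v ≟B true
  ... | no ¬uv = record
      { Sides S
      ; split = λ where
          _ _ (here refl) a → ⊥-elim (¬uv a)
          x y (there e) a → Sides.split S x y e a }
  ... | yes uv with Sides.comp S u ≟F Sides.comp S v
  ... | no apart = Join.join S uv apart
  ... | yes together with Sides.side S u ≟B not (Sides.side S v)
  ... | yes differ = record
      { Sides S
      ; split = λ where
          _ _ (here refl) _ → together , differ
          x y (there e) a → Sides.split S x y e a }
  -- Equal sides give a walk of even length from `u` to `v`, which the edge `uv` closes up to an odd
  -- one.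
  ... | no same = ⊥-elim (noOdd (suc m) v
        (trans (cong not parity) (closing _ _ same)) (step (Adj-sym G uv) p))
    where
    m = proj₁ (Sides.joined S u v together)
    p = proj₁ (proj₂ (Sides.joined S u v together))
    parity = proj₂ (proj₂ (Sides.joined S u v together))

  sides : ∀ es → Sides es
  sides [] = record
    { comp = λ x → x
    ; side = λ _ → false
    ; joined = λ { x .x refl → 0 , here , refl }
    ; split = λ { _ _ () } }
  sides ((u , v) ∷ es) = addEdge u v (sides es)

  bipartition : Σ (V → Bool) λ s → ∀ u v → Adj G u v → s u ≢ s v
  bipartition = Sides.side S , λ u v a eq →
    not-¬ eq (proj₂ (Sides.split S u v (∈-cartesianProduct⁺ (∈-allFin u) (∈-allFin v)) a))
    where S = sides (cartesianProduct (allFin (n G)) (allFin (n G)))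

-- A closed walk as a periodic sequence over all of `ℕ`, so that stretches running past the starting
-- point and changes of starting point are mere shifts of the index.
record Tour (G : Graph) (m : ℕ) : Set where
  field
    at : ℕ → Fin (n G)
    edge : ∀ t → Adj G (at t) (at (suc t))
    period : ∀ t → at (m + t) ≡ at t

  segment : ∀ i d → Walk G (at i) (at (d + i)) d
  segment i zero = here
  segment i (suc d) = step (edge i) (subst (λ t → Walk G (at (suc i)) (at t) d) (+-suc d i) (segment (suc i) d))

rotate : ∀ {G m} → ℕ → Tour G m → Tour G m
rotate {m = m} k T = record
  { at = λ t → at (t + k)
  ; edge = λ t → edge (t + k)
  ; period = λ t → trans (cong at (+-assoc m t k)) (period (t + k)) }
  where open Tour T

nth : ∀ {G u v m} → Walk G u v m → ℕ → Fin (n G)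
nth {u = u} here _ = u
nth {u = u} (step _ _) zero = u
nth (step _ p) (suc t) = nth p t

nth-first : ∀ {G u v m} (p : Walk G u v m) → nth p 0 ≡ u
nth-first here = refl
nth-first (step _ _) = refl

nth-last : ∀ {G u v m} (p : Walk G u v m) → nth p m ≡ v
nth-last here = refl
nth-last (step _ p) = nth-last p

nth-edge : ∀ {G u v m} (p : Walk G u v m) {t} → t < m → Adj G (nth p t) (nth p (suc t))
nth-edge {G} (step {u = u} e p) {zero} _ = subst (Adj G u) (sym (nth-first p)) e
nth-edge (step _ p) {suc t} t<m = nth-edge p (s<s⁻¹ t<m)

suc-% : ∀ t m .{{_ : NonZero m}} → suc t % m ≡ suc (t % m) % m
suc-% t m = trans (%-distribˡ-+ 1 t m) (trans (cong (λ r → (1 % m + r) % m) (sym (m%n%n≡m%n t m))) (sym (%-distribˡ-+ 1 (t % m) m)))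

tour : ∀ {G u m} .{{_ : NonZero m}} → Walk G u u m → Tour G m
tour {G} {u} {m} p = record
  { at = λ t → nth p (t % m)
  ; edge = edge
  ; period = λ t → cong (nth p) (trans (cong (_% m) (+-comm m t)) ([m+n]%n≡m%n t m)) }
  where
  edge : ∀ t → Adj G (nth p (t % m)) (nth p (suc t % m))
  edge t with m≤n⇒m<n∨m≡n (m%n<n t m)
  ... | inj₁ lt = subst (Adj G _) (cong (nth p) (sym (trans (suc-% t m) (m<n⇒m%n≡m lt)))) (nth-edge p (m%n<n t m))
  -- The last edge of a period leads to the end of the walk, which is also its beginning.
  ... | inj₂ eq = subst (Adj G _)
    (trans (cong (nth p) eq) (trans (nth-last p) (trans (sym (nth-first p))
      (cong (nth p) (sym (trans (suc-% t m) (trans (cong (_% m) eq) (n%n≡0 m))))))))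
    (nth-edge p (m%n<n t m))

Simple : ∀ {G m} → Tour G m → Set
Simple {m = m} T = ∀ i d → suc d < m → at (suc d + i) ≢ at i
  where open Tour T

-- A repeated vertex cuts an odd closed walk into two, one of them odd and shorter.
noSimpleOddTour⇒noOddClosedWalk : ∀ {G} →
  (∀ m → odd m ≡ true → (T : Tour G m) → ¬ Simple T) → NoOddClosedWalk G
noSimpleOddTour⇒noOddClosedWalk {G} noTour = <-rec _ shorten
  where
  shorten : ∀ m → (∀ {l} → l < m → ∀ u → odd l ≡ true → ¬ Walk G u u l) → ∀ u → odd m ≡ true → ¬ Walk G u u m
  shorten (suc r) rec u odd-m p = noTour (suc r) odd-m T simple
    where
    m = suc r
    T = tour p
    open Tour T
    simple : Simple T
    simple i d d<m eq with odd (suc d) in odd-d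
    ... | true = rec d<m (at i) odd-d (subst (λ v → Walk G (at i) v (suc d)) eq (segment i (suc d)))
    ... | false = rec (∸-monoʳ-< z<s (<⇒≤ d<m)) (at (suc d + i)) odd-rest
      (subst (λ v → Walk G (at (suc d + i)) v rest) back (segment (suc d + i) rest))
      where
      rest = m ∸ suc d
      rest+ : rest + suc d ≡ m
      rest+ = m∸n+n≡m (<⇒≤ d<m)
      back : at (rest + (suc d + i)) ≡ at (suc d + i)
      back = trans (cong at (trans (sym (+-assoc rest (suc d) i)) (cong (_+ i) rest+))) (trans (period i) (sym eq))
      odd-rest : odd rest ≡ true
      odd-rest = trans (sym (trans (odd-+ rest (suc d)) (trans (cong (odd rest xor_) odd-d) (xor-identityʳ _))))
        (trans (cong odd rest+) odd-m)

-- Sequences of colours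

-- Colours are shifted as in Defs: colour c stands for the paper's colour c + 1.
SpacedSequence : (ℕ → ℕ) → Set
SpacedSequence s = ∀ i d → d ≤ s i → s (suc d + i) ≢ s i

occursIn : ℕ → ℕ → List ℕ → Bool
occursIn c (suc k) (x ∷ h) = (c ≡ᵇ x) ∨ occursIn c k h
occursIn c _ _ = false

-- Whether no spaced sequence with values in {1,…,5} extends the history h
-- (latest value first) by k terms; the second function does the same for k + 1
-- terms whose first one is at most b.
exhausted : ℕ → List ℕ → Bool
exhaustedBelow : ℕ → List ℕ → ℕ → Bool
exhausted zero h = false
exhausted (suc k) h = exhaustedBelow k h 5
exhaustedBelow k h zero = true
exhaustedBelow k h (suc b) = (occursIn (suc b) (2 + b) h ∨ exhausted k (suc b ∷ h)) ∧ exhaustedBelow k h b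

exhaustedBelow-at : ∀ k h {b c} → 0 < c → c ≤ b → exhaustedBelow k h b ≡ true →
  occursIn c (suc c) h ∨ exhausted k (c ∷ h) ≡ true
exhaustedBelow-at k h {zero} z<s () _
exhaustedBelow-at k h {suc b} c>0 c≤b eq with m≤n⇒m<n∨m≡n c≤b
... | inj₁ c<b = exhaustedBelow-at k h c>0 (s≤s⁻¹ c<b) (∧-conicalʳ _ _ eq)
... | inj₂ refl = ∧-conicalˡ _ _ eq

module _ (s : ℕ → ℕ) (s>0 : ∀ t → 0 < s t) (s≤5 : ∀ t → s t ≤ 5) (spaced : SpacedSequence s) where

  history : ℕ → List ℕ
  history zero = []
  history (suc t) = s t ∷ history t

  occursIn-sound : ∀ c k t → occursIn c k (history t) ≡ true → ∃[ d ] ∃[ i ] (d < k × t ≡ suc d + i × c ≡ s i)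
  occursIn-sound c (suc k) (suc t) eq with c ≡ᵇ s t in c≡
  ... | true = 0 , t , z<s , refl , ≡ᵇ⇒≡ c (s t) (Equivalence.from T-≡ c≡)
  ... | false with occursIn-sound c k t eq
  ... | d , i , d<k , t≡ , c≡si = suc d , i , s<s d<k , cong suc t≡ , c≡si

  -- Following the terms of `s` through the search tree never meets a pruned branch, so the search
  -- runs out of depth, where its answer is `false`.
  not-exhausted : ∀ k t → exhausted k (history t) ≢ true
  not-exhausted (suc k) t eq
    with occursIn (s t) (suc (s t)) (history t) in found | exhaustedBelow-at k (history t) (s>0 t) (s≤5 t) eq
  ... | false | more = not-exhausted k (suc t) more
  ... | true | _ with occursIn-sound (s t) (suc (s t)) t found
  ... | d , i , d<k , t≡ , c≡ = spaced i d (≤-trans (s≤s⁻¹ d<k) (≤-reflexive c≡)) (trans (cong s (sym t≡)) c≡)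

  no-spacedSequence : ⊥
  -- Evaluation of the search: no spaced sequence has 35 terms.
  no-spacedSequence = not-exhausted 35 0 refl

-- Triangle-free graphs with a packing colouring

-- The edges of G inside P; the vertices outside P become isolated.
restrict : (G : Graph) {P : Fin (n G) → Set} → (∀ v → Dec (P v)) → Graph
restrict G P? = record
  { n = n G
  ; adj = λ u v → adj G u v ∧ (does (P? u) ∧ does (P? v))
  ; symm = λ u v → cong₂ _∧_ (symm G u v) (∧-comm (does (P? u)) (does (P? v)))
  ; irrefl = λ v → cong (_∧ (does (P? v) ∧ does (P? v))) (irrefl G v) }

module _ (G : Graph) {P : Fin (n G) → Set} (P? : ∀ v → Dec (P v)) where

  restrict-adj⁺ : ∀ {u v} → Adj G u v → P u → P v → Adj (restrict G P?) u v
  restrict-adj⁺ {u} {v} a pu pv = cong₂ _∧_ a (cong₂ _∧_ (dec-true (P? u) pu) (dec-true (P? v) pv))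

  restrict-adj⁻ : ∀ {u v} → Adj (restrict G P?) u v → Adj G u v × P u × P v
  restrict-adj⁻ {u} {v} a with adj G u v | P? u | P? v
  restrict-adj⁻ refl | true | yes pu | yes pv = refl , pu , pv
  restrict-adj⁻ () | true | yes _ | no _
  restrict-adj⁻ () | true | no _ | _
  restrict-adj⁻ () | false | _ | _

-- The packing condition in positive form: vertices of one colour that are too close coincide. Since
-- colours start at 0, colour `c` forbids distances up to `c + 1`.
Spaced : (G : Graph) → (Fin (n G) → ℕ) → Set
Spaced G col = ∀ {u v m} → Walk G u v m → m ≤ suc (col u) → col u ≡ col v → u ≡ v

packing⇒spaced : ∀ {G k} (c : Fin (n G) → Fin k) → PackingColouring G k c → Spaced G (toℕ ∘ c)
packing⇒spaced c packing {u} {v} {m} walk m≤ same with u ≟F v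
... | yes u≡v = u≡v
... | no u≢v = ⊥-elim (packing (c u) u v refl (sym (toℕ-injective same)) u≢v (m , m≤ , walk))

walk₁ : ∀ {G u v} → Adj G u v → Walk G u v 1
walk₁ a = step a here

module ThreeColouring (G : Graph) (triangleFree : TriangleFree G)
  (col : Fin (n G) → ℕ) (spaced : Spaced G col) where

  private
    V : Set
    V = Fin (n G)

    _~_ : V → V → Set
    _~_ = Adj G

    ~-sym : ∀ {u v} → u ~ v → v ~ u
    ~-sym = Adj-sym G

    _~?_ : ∀ u v → Dec (u ~ v)
    u ~? v = adj G u v ≟B true

  ~⇒col≢ : ∀ {u v} → u ~ v → col u ≢ col v
  ~⇒col≢ a same = Adj⇒≢ G a (spaced (walk₁ a) (s≤s z≤n) same)

  -- Rich vertices and the core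

  record Rich (u : V) : Set where
    constructor rich
    field
      colour0 : col u ≡ 0
      three : ∃[ x ] ∃[ y ] ∃[ z ] ((u ~ x × col x ≤ 5) × (u ~ y × col y ≤ 5) × (u ~ z × col z ≤ 5) ×
        x ≢ y × x ≢ z × y ≢ z)

  abstract
    rich? : ∀ u → Dec (Rich u)
    rich? u = map′ (λ (c , t) → rich c t) (λ (rich c t) → c , t)
      (col u ≟ 0 ×-dec any? λ x → any? λ y → any? λ z →
        near? x ×-dec near? y ×-dec near? z ×-dec ¬? (x ≟F y) ×-dec ¬? (x ≟F z) ×-dec ¬? (y ≟F z))
      where
      near? : ∀ x → Dec (u ~ x × col x ≤ 5)
      near? x = u ~? x ×-dec col x ≤? 5

  -- The vertices with colours 1 to 5 that are left out have colour 1 and no rich neighbour, so they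
  -- can share a colour class with the rich vertices.
  Core : V → Set
  Core v = (0 < col v × col v ≤ 5) × (col v ≡ 1 → ∃[ u ] (u ~ v × Rich u))

  abstract
    core? : ∀ v → Dec (Core v)
    core? v = (0 <? col v ×-dec col v ≤? 5) ×-dec (col v ≟ 1 →-dec any? λ u → u ~? v ×-dec rich? u)

  core : Graph
  core = restrict G core?

  -- Odd tours of the core

  module CoreTour {m} (T : Tour core m) where
    open Tour T public

    abstract
      edge' : ∀ t → at t ~ at (suc t)
      edge' t = proj₁ (restrict-adj⁻ G core? (edge t))

      inCore : ∀ t → Core (at t)
      inCore t = proj₁ (proj₂ (restrict-adj⁻ G core? (edge t)))

    walk : ∀ i d → Walk G (at i) (at (d + i)) d
    walk = Tour.segment {G} record { at = at ; edge = edge' ; period = period }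

  -- Colours are at most 5, so only gaps up to 6 matter; these are shorter than the tour and hence
  -- join distinct vertices.
  no-long-tour : ∀ {m} → 7 ≤ m → (T : Tour core m) → ¬ Simple T
  no-long-tour 7≤m T simple = no-spacedSequence (col ∘ at) (λ t → proj₁ (proj₁ (inCore t))) ≤5
    λ i d d≤ same → simple i d (<-≤-trans (s<s (s≤s (≤-trans d≤ (≤5 i)))) 7≤m)
      (sym (spaced (walk i (suc d)) (s≤s d≤) (sym same)))
    where
    open CoreTour T
    ≤5 : ∀ t → col (at t) ≤ 5
    ≤5 t = proj₂ (proj₁ (inCore t))

  module Pentagon (T : Tour core 5) where
    open CoreTour T

    -- Otherwise the other three edges would form a triangle.
    near : ∀ i → at (2 + i) ≢ at i
    near i eq = triangleFree (edge' (2 + i)) (edge' (3 + i)) (subst (at (4 + i) ~_) (trans (period i) (sym eq)) (edge' (4 + i)))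

    col≢₁ : ∀ i → col (at i) ≢ col (at (1 + i))
    col≢₁ i = ~⇒col≢ (edge' i)

    -- Core colours are at least 1, so their classes are 2-packings.
    col≢₂ : ∀ i → col (at i) ≢ col (at (2 + i))
    col≢₂ i same = near i (sym (spaced (walk i 2) (s≤s (proj₁ (proj₁ (inCore i)))) same))

    col≢ : ∀ i d → d < 4 → col (at i) ≢ col (at (suc d + i))
    col≢ i 0 _ = col≢₁ i
    col≢ i 1 _ = col≢₂ i
    -- Gaps 3 and 4 are gaps 2 and 1 the other way round the pentagon.
    col≢ i 2 _ same = col≢₂ (3 + i) (trans (sym same) (cong col (sym (period i))))
    col≢ i 3 _ same = col≢₁ (4 + i) (trans (sym same) (cong col (sym (period i))))
    col≢ i (suc (suc (suc (suc _)))) (s≤s (s≤s (s≤s (s≤s ()))))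

    abstract
      colour : Fin 5 → Fin 5
      colour t = fromℕ< {col (at (toℕ t)) ∸ 1} (pred-< (inCore (toℕ t)))
        where
        pred-< : ∀ {v} → Core v → col v ∸ 1 < 5
        pred-< {v} ((pos , ≤5) , _) = ≤-trans (≤-reflexive (m+[n∸m]≡n pos)) ≤5

      colour-spec : ∀ t → suc (toℕ (colour t)) ≡ col (at (toℕ t))
      colour-spec t = trans (cong suc (toℕ-fromℕ< _)) (m+[n∸m]≡n (proj₁ (proj₁ (inCore (toℕ t)))))

    colour-distinct : ∀ {i j} → i Fin.< j → colour i ≢ colour j
    colour-distinct {i} {j} i<j same = col≢ (toℕ i) d d<4
      (trans (sym (colour-spec i)) (trans (cong (suc ∘ toℕ) same) (trans (colour-spec j) (cong (col ∘ at) (sym j≡)))))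
      where
      d = toℕ j ∸ suc (toℕ i)
      j≡ : suc d + toℕ i ≡ toℕ j
      j≡ = trans (sym (+-suc d (toℕ i))) (m∸n+n≡m i<j)
      d<4 : d < 4
      d<4 = ≤-trans (m≤m+n (suc d) (toℕ i)) (≤-trans (≤-reflexive j≡) (s≤s⁻¹ (toℕ<n j)))

    abstract
      allColours : ∀ c → 0 < c → c ≤ 5 → ∃[ t ] col (at (toℕ {5} t)) ≡ c
      allColours (suc c) _ c<5 with distinct⇒surjective colour colour-distinct (fromℕ< c<5)
      ... | t , eq = t , trans (sym (colour-spec t)) (cong suc (trans (cong toℕ (sym eq)) (toℕ-fromℕ< c<5)))

  -- A rich neighbour u of the vertex of colour 1 on a pentagon has two further
  -- neighbours. The pentagon carries all of the colours 1,…,5, so such a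
  -- neighbour lies on the pentagon, or else has colour 2.
  module RichNeighbour (T : Tour core 5) (col₀ : col (Tour.at T 0) ≡ 1)
    (u : V) (u~₀ : u ~ Tour.at T 0) (u-rich : Rich u) where
    open CoreTour T
    open Pentagon T using (allColours)

    closing : at 4 ~ at 0
    closing = subst (at 4 ~_) (period 0) (edge' 4)

    -- The walk from `y` through `u` and `at 0` to `at 2` or `at 3` has length 4, so equal colours
    -- force equal vertices only from colour 3 on; colour 2 remains as an exception.
    data Place (y : V) : Set where
      on₂ : y ≡ at 2 → Place y
      on₃ : y ≡ at 3 → Place y
      off₂ : col y ≡ 2 → col (at 2) ≡ 2 → Place y
      off₃ : col y ≡ 2 → col (at 3) ≡ 2 → Place y

    -- Colour 0 is that of `u`; colour 1 is that of `at 0`, two steps away.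
    col≥2 : ∀ {y} → u ~ y → y ≢ at 0 → 2 ≤ col y
    col≥2 {y} u~y y≢ with col y in eq
    ... | 0 = ⊥-elim (~⇒col≢ u~y (trans (Rich.colour0 u-rich) (sym eq)))
    ... | 1 = ⊥-elim (y≢ (spaced (step (~-sym u~y) (walk₁ u~₀)) (s≤s (≤-trans (s≤s z≤n) (≤-reflexive (sym eq)))) (trans eq (sym col₀))))
    ... | suc (suc _) = s≤s (s≤s z≤n)

    not-adjacent : ∀ {y z} → u ~ y → u ~ z → ¬ (y ~ z)
    not-adjacent u~y u~z y~z = triangleFree u~y y~z (~-sym u~z)

    place : ∀ {y} → u ~ y → col y ≤ 5 → y ≢ at 0 → Place y
    place {y} u~y y≤5 y≢ = go (allColours (col y) (≤-trans (s≤s z≤n) y≥2) y≤5)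
      where
      y≥2 = col≥2 u~y y≢
      via : ∀ {v m} → Walk G (at 0) v m → Walk G y v (2 + m)
      via p = step (~-sym u~y) (step u~₀ p)
      opposite : ∀ {v} → Walk G (at 0) v 2 → col v ≡ col y → y ≡ v ⊎ col y ≡ 2
      opposite p same with col y ≟ 2
      ... | yes y≡2 = inj₂ y≡2
      ... | no y≢2 = inj₁ (spaced (via p) (s≤s (≤∧≢⇒< y≥2 (y≢2 ∘ sym))) (sym same))
      -- Length 3 is short enough for every colour from 2 on, so `y` would be `v` and form a
      -- triangle with `u` and `at 0`.
      beside : ∀ {v} → at 0 ~ v → col v ≢ col y
      beside a same = not-adjacent u~₀ u~y
        (subst (at 0 ~_) (sym (spaced (via (walk₁ a)) (s≤s y≥2) (sym same))) a)
      go : ∃[ t ] col (at (toℕ {5} t)) ≡ col y → Place y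
      go (0F , same) = ⊥-elim (<⇒≢ y≥2 (trans (sym col₀) same))
      go (1F , same) = ⊥-elim (beside (edge' 0) same)
      go (2F , same) with opposite (walk 0 2) same
      ... | inj₁ y≡ = on₂ y≡
      ... | inj₂ y≡2 = off₂ y≡2 (trans same y≡2)
      go (3F , same) with opposite (step (~-sym closing) (walk₁ (~-sym (edge' 3)))) same
      ... | inj₁ y≡ = on₃ y≡
      ... | inj₂ y≡2 = off₃ y≡2 (trans same y≡2)
      go (4F , same) = ⊥-elim (beside (~-sym closing) same)

    -- The walk from `y` through `u` and `p` to `q` has length 3, so `y` would be `q` and form a
    -- triangle with `u` and `p`.
    off-edge : ∀ {y p q} → u ~ y → u ~ p → p ~ q → col y ≡ 2 → col q ≡ 2 → ⊥
    off-edge u~y u~p p~q y≡2 q≡2 =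
      not-adjacent u~p u~y (subst (_ ~_) (sym y≡q) p~q)
      where
      y≡q = spaced (step (~-sym u~y) (step u~p (walk₁ p~q))) (s≤s (≤-reflexive (sym y≡2))) (trans y≡2 (sym q≡2))

    -- Having the common neighbour `u`, the vertices `y` and `z` differ in colour and are not
    -- adjacent. Each pair of places breaks this, directly or through the edge between `at 2` and
    -- `at 3`.
    clash : ∀ {y z} → u ~ y → u ~ z → y ≢ at 0 → y ≢ z → Place y → Place z → ⊥
    clash {y} {z} u~y u~z y≢₀ y≢z = go
      where
      colours : col y ≢ col z
      colours same = y≢z (spaced (step (~-sym u~y) (walk₁ u~z)) (s≤s (≤-trans (s≤s z≤n) (col≥2 u~y y≢₀))) same)
      go : Place y → Place z → ⊥
      go (on₂ p) (on₂ q) = y≢z (trans p (sym q))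
      go (on₃ p) (on₃ q) = y≢z (trans p (sym q))
      go (on₂ refl) (on₃ refl) = not-adjacent u~y u~z (edge' 2)
      go (on₃ refl) (on₂ refl) = not-adjacent u~z u~y (edge' 2)
      go (on₂ refl) (off₂ c₁ c₂) = colours (trans c₂ (sym c₁))
      go (on₂ refl) (off₃ c₁ c₂) = off-edge u~z u~y (edge' 2) c₁ c₂
      go (on₃ refl) (off₂ c₁ c₂) = off-edge u~z u~y (~-sym (edge' 2)) c₁ c₂
      go (on₃ refl) (off₃ c₁ c₂) = colours (trans c₂ (sym c₁))
      go (off₂ c₁ c₂) (on₂ refl) = colours (trans c₁ (sym c₂))
      go (off₃ c₁ c₂) (on₂ refl) = off-edge u~y u~z (edge' 2) c₁ c₂
      go (off₂ c₁ c₂) (on₃ refl) = off-edge u~y u~z (~-sym (edge' 2)) c₁ c₂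
      go (off₃ c₁ c₂) (on₃ refl) = colours (trans c₁ (sym c₂))
      go (off₂ c _) (off₂ c' _) = colours (trans c (sym c'))
      go (off₂ c _) (off₃ c' _) = colours (trans c (sym c'))
      go (off₃ c _) (off₂ c' _) = colours (trans c (sym c'))
      go (off₃ c _) (off₃ c' _) = colours (trans c (sym c'))

    two : ∀ {y z} → (u ~ y × col y ≤ 5) → (u ~ z × col z ≤ 5) → y ≢ at 0 → z ≢ at 0 → y ≢ z → ⊥
    two (u~y , y≤5) (u~z , z≤5) y≢₀ z≢₀ y≢z = clash u~y u~z y≢₀ y≢z (place u~y y≤5 y≢₀) (place u~z z≤5 z≢₀)

    impossible : ⊥
    impossible with Rich.three u-rich
    ... | x , y , z , nx , ny , nz , x≢y , x≢z , y≢z with x ≟F at 0 | y ≟F at 0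
    ... | no x≢₀ | no y≢₀ = two nx ny x≢₀ y≢₀ x≢y
    ... | yes refl | _ = two ny nz (x≢y ∘ sym) (x≢z ∘ sym) y≢z
    ... | no x≢₀ | yes refl = two nx nz x≢₀ (y≢z ∘ sym) x≢z

  no-pentagon : ¬ Tour core 5
  no-pentagon T with Pentagon.allColours T 1 (s≤s z≤n) (s≤s z≤n)
  ... | t , col₁ with proj₂ (CoreTour.inCore T (toℕ t)) col₁
  -- Rotation moves the vertex of colour 1 to position 0.
  ... | u , u~ , u-rich = RichNeighbour.impossible (rotate (toℕ t) T) col₁ u u~ u-rich

  no-odd-tour : ∀ m → odd m ≡ true → (T : Tour core m) → ¬ Simple T
  no-odd-tour 1 _ T _ = Adj⇒≢ core (Tour.edge T 0) (sym (Tour.period T 0))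
  no-odd-tour 3 _ T _ = triangleFree (edge' 0) (edge' 1) (subst (at 2 ~_) (period 0) (edge' 2))
    where open CoreTour T
  no-odd-tour 5 _ T _ = no-pentagon T
  no-odd-tour (suc (suc (suc (suc (suc (suc (suc m))))))) _ = no-long-tour (m≤m+n 7 m)

  -- From the bipartition to three colours

  open Bipartition core (noSimpleOddTour⇒noOddClosedWalk no-odd-tour) using (bipartition)

  private
    sideColour : Bool → Fin 3
    sideColour false = 0F
    sideColour true = 1F

    sideColour-injective : ∀ {a b} → sideColour a ≡ sideColour b → a ≡ b
    sideColour-injective {false} {false} _ = refl
    sideColour-injective {true} {true} _ = refl

    sideColour≢2 : ∀ b → sideColour b ≢ 2F
    sideColour≢2 false ()
    sideColour≢2 true ()

  -- Meant for colours 1 to 5, where `2F` marks the vertices of colour 1 without a rich neighbour;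
  -- elsewhere `2F` is a default.
  base : V → Fin 3
  base v with core? v
  ... | yes _ = sideColour (proj₁ bipartition v)
  ... | no _ = 2F

  outside-core : ∀ {v} → 0 < col v → col v ≤ 5 → ¬ Core v → col v ≡ 1
  outside-core {v} pos ≤5 ¬core with col v ≟ 1
  ... | yes eq = eq
  ... | no neq = ⊥-elim (¬core ((pos , ≤5) , λ eq → ⊥-elim (neq eq)))

  base-proper : ∀ {u v} → u ~ v → 0 < col u → 0 < col v → col u ≤ 5 → col v ≤ 5 → base u ≢ base v
  base-proper {u} {v} a u>0 v>0 u≤5 v≤5 eq with core? u | core? v
  ... | yes cu | yes cv = proj₂ bipartition u v (restrict-adj⁺ G core? a cu cv) (sideColour-injective eq)
  ... | yes _ | no _ = sideColour≢2 _ eq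
  ... | no _ | yes _ = sideColour≢2 _ (sym eq)
  ... | no ¬cu | no ¬cv = ~⇒col≢ a (trans (outside-core u>0 u≤5 ¬cu) (sym (outside-core v>0 v≤5 ¬cv)))

  -- Such a neighbour has nonzero colour and, thanks to `u`, belongs to the core. Hence `2F` is free
  -- for rich vertices.
  rich⇒base≢2 : ∀ {u v} → u ~ v → Rich u → col v ≤ 5 → base v ≢ 2F
  rich⇒base≢2 {u} {v} a u-rich v≤5 eq with core? v
  ... | yes _ = sideColour≢2 _ eq
  ... | no ¬cv = ¬cv ((n≢0⇒n>0 (λ v≡0 → ~⇒col≢ a (trans (Rich.colour0 u-rich) (sym v≡0))) , v≤5) , λ _ → u , a , u-rich)

  FreeColour : V → Fin 3 → Set
  FreeColour u t = ∀ {v} → u ~ v → col v ≤ 5 → base v ≢ t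

  freeColour : ∀ u → col u ≡ 0 → ∃[ t ] FreeColour u t
  freeColour u u≡0 with rich? u
  ... | yes r = 2F , λ a → rich⇒base≢2 a r
  ... | no ¬r with used? 0F | used? 1F | used? 2F
    where
    used? : ∀ t → Dec (∃[ v ] ((u ~ v × col v ≤ 5) × base v ≡ t))
    used? t = any? λ v → (u ~? v ×-dec col v ≤? 5) ×-dec base v ≟F t
  ... | no free | _ | _ = 0F , λ a b eq → free (_ , (a , b) , eq)
  ... | _ | no free | _ = 1F , λ a b eq → free (_ , (a , b) , eq)
  ... | _ | _ | no free = 2F , λ a b eq → free (_ , (a , b) , eq)
  -- Neighbours with three different `base` colours are distinct, which would make `u` rich.
  ... | yes (x , nx , bx) | yes (y , ny , by) | yes (z , nz , bz) = ⊥-elim (¬r (rich u≡0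
    (x , y , z , nx , ny , nz , apart bx by (λ ()) , apart bx bz (λ ()) , apart by bz (λ ()))))
    where
    apart : ∀ {a b s t} → base a ≡ s → base b ≡ t → s ≢ t → a ≢ b
    apart refl refl s≢t a≡b = s≢t (cong base a≡b)

  -- Vertices of colour 0 are pairwise non-adjacent, so each can be coloured last, independently of
  -- the others.
  threeColour : V → Fin 3
  threeColour v with col v ≟ 0
  ... | yes v≡0 = proj₁ (freeColour v v≡0)
  ... | no _ = base v

  threeColour-proper : ∀ {u v} → u ~ v → col u ≤ 5 → col v ≤ 5 → threeColour u ≢ threeColour v
  threeColour-proper {u} {v} a u≤5 v≤5 eq with col u ≟ 0 | col v ≟ 0
  ... | yes u≡0 | yes v≡0 = ~⇒col≢ a (trans u≡0 (sym v≡0))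
  ... | yes u≡0 | no _ = proj₂ (freeColour u u≡0) a v≤5 (sym eq)
  ... | no _ | yes v≡0 = proj₂ (freeColour v v≡0) (~-sym a) u≤5 eq
  ... | no u≢0 | no v≢0 = base-proper a (n≢0⇒n>0 u≢0) (n≢0⇒n>0 v≢0) u≤5 v≤5 eq

-- Colouring the whole graph

saveThreeColours : (G : Graph) → TriangleFree G → ∀ j → PackingColourable G (6 + j) → Colourable G (3 + j)
saveThreeColours G triangleFree j (c , packing) = f , proper
  where
  col : Fin (n G) → ℕ
  col = toℕ ∘ c
  open ThreeColouring G triangleFree col (packing⇒spaced c packing)

  f : Fin (n G) → Fin (3 + j)
  f v with splitAt 6 (c v)
  ... | inj₁ _ = threeColour v ↑ˡ j
  ... | inj₂ b = 3 ↑ʳ b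

  low : ∀ {v i} → splitAt 6 (c v) ≡ inj₁ i → col v ≤ 5
  low {v} {i} eq = s≤s⁻¹ (subst (_< 6) (trans (sym (toℕ-↑ˡ i j)) (cong toℕ (splitAt⁻¹-↑ˡ eq))) (toℕ<n i))

  ↑ˡ≢↑ʳ : ∀ (a : Fin 3) (b : Fin j) → a ↑ˡ j ≢ 3 ↑ʳ b
  ↑ˡ≢↑ʳ a b eq with trans (sym (splitAt-↑ˡ 3 a j)) (trans (cong (splitAt 3) eq) (splitAt-↑ʳ 3 j b))
  ... | ()

  proper : ProperColouring G (3 + j) f
  proper u v a eq with splitAt 6 (c u) in su | splitAt 6 (c v) in sv
  ... | inj₁ _ | inj₁ _ = threeColour-proper a (low su) (low sv) (↑ˡ-injective j _ _ eq)
  ... | inj₁ _ | inj₂ _ = ↑ˡ≢↑ʳ _ _ eq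
  ... | inj₂ _ | inj₁ _ = ↑ˡ≢↑ʳ _ _ (sym eq)
  ... | inj₂ _ | inj₂ _ = ~⇒col≢ a (cong toℕ
    (trans (sym (splitAt⁻¹-↑ʳ su)) (trans (cong (6 ↑ʳ_) (↑ʳ-injective 3 _ _ eq)) (splitAt⁻¹-↑ʳ sv))))

theorem3p6 : (k : ℕ) → 4 ≤ k → (G : Graph) →
    ¬ (CliqueNumber G 2 × ChromaticNumber G k × PackingChromaticNumber G (k + 2))
theorem3p6 k 4≤k G (ω≡2 , (_ , χ-least) , (colourable , _)) = 1+n≰n (subst (_≤ 3 + j) k≡ (χ-least (3 + j)
    (saveThreeColours G (ω≡2⇒triangleFree G ω≡2) j (subst (PackingColourable G) k+2≡ colourable))))
  where
  -- The number of packing classes beyond the first six; `3 + j` is one less than `k`.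
  j = k ∸ 4
  k≡ : k ≡ 4 + j
  k≡ = sym (m+[n∸m]≡n 4≤k)
  k+2≡ : k + 2 ≡ 6 + j
  k+2≡ = trans (+-comm k 2) (cong (2 +_) k≡)
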